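{- Let $t,n$ be rational integers and let $\omega$ be a real quadratic irrational with $\omega^2-t\omega+n=0$. Let $h\ge 1$ and suppose that the continued fraction expansion of $\omega$ commences $\omega=[\,A,a_1,a_2,\ldots,a_h,(\omega+P)/Q\,]$, where $A$ is an integer, $a_1,\ldots,a_h$ are positive integers, and $(\omega+P)/Q$, with $P,Q$ integers, is the complete quotient following $a_h$. Define integers $p,p',q,q'$ by $$\begin{pmatrix} a_1 & 1\\ 1& 0\end{pmatrix}\cdots\begin{pmatrix} a_h & 1\\ 1& 0\end{pmatrix}=\begin{pmatrix} p & p'\\ q& q'\end{pmatrix}.$$ Put $k=A-t-P$, and let $T=t-2A$ and $N=A^2-tA+n$ be the trace and norm of $\omega-A$. Then there exist integers $K_1,K_2,L$ such that all of the following hold: $$P^2+tP+n=(-1)^{h+1}Q(q'^2-K_1p'),\qquad -(A+P)=(-1)^{h+1}(qq'-K_1p),$$ $$A^2-tA+n=(-1)^{h+1}(q'^2Q-K_2q),\qquad -(A+P)=(-1)^{h+1}(p'q'Q-K_2p),$$ $$K_2-K_1=kq',\qquad (-1)^{h+1}k=qq'-Lp',\qquad (-1)^{h+1}Q=q^2-Lp,\qquad L=q'Q-kq,$$ $$T=(-1)^h(K_1p-Lp'),\qquad N=(-1)^h(K_1q-Lq').$$ In particular the discriminant $t^2-4n=T^2-4N$ is a quadratic polynomial expression in $K_1$ and $L$ with coefficients determined by $a_1,\ldots,a_h$.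
   Context: Continued fraction notation: $[a_0]=a_0$ and $[a_0,a_1,\ldots,a_m]=a_0+1/[a_1,\ldots,a_m]$, where the last entry may be any real number (a complete quotient). The complete quotients $\alpha_{j}$ of $\alpha=[a_0,a_1,a_2,\ldots]$ are defined by $\alpha=[a_0,a_1,\ldots,a_{j-1},\alpha_{j}]$. For a quadratic irrational integer $\omega$, every complete quotient has the form $\omega_j=(\omega+P_j)/Q_j$ with $P_j,Q_j$ rational integers, $Q_j\ne 0$, and $Q_j$ divides $P_j^2+tP_j+n$; more precisely $P_{j+1}^2+tP_{j+1}+n=-Q_jQ_{j+1}$. Here $P=P_{h+1}$ and $Q=Q_{h+1}$. -}

module Defs where

open import Data.Integer as ℤ using (ℤ; 0ℤ; 1ℤ)
open import Data.List.Base using (List; []; _∷_)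
open import Data.Nat as ℕ using (ℕ)
import Data.Nat.Properties as ℕ
open import Data.Product using (∃; _×_; _,_)
open import Data.Rational as ℚ using (ℚ; 0ℚ; 1ℚ; ½)
import Data.Rational.Properties as ℚ
open import Data.Rational.Solver using (module +-*-Solver)
open import Data.Sum using (_⊎_)
open import Data.Vec.Base using (Vec; []; _∷_)
open import Relation.Binary.PropositionalEquality
  using (_≡_; _≢_; refl; sym; trans; cong; subst; module ≡-Reasoning)
open import Relation.Nullary using (¬_)

------------------------------------------------------------------------
-- Real numbers: Cauchy sequences of rationals, compared by the setoid
-- equality _≈_ ("the difference tends to 0"), with termwise arithmetic.

Eventually : (ℕ → Set) → Set
Eventually P = ∃ λ N → ∀ n → N ℕ.≤ n → P n

IsCauchy : (ℕ → ℚ) → Set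
IsCauchy x = ∀ ε → 0ℚ ℚ.< ε →
  ∃ λ N → ∀ m n → N ℕ.≤ m → N ℕ.≤ n → ℚ.∣ x m ℚ.- x n ∣ ℚ.< ε

record ℝ : Set where
  constructor mkℝ
  field
    seq    : ℕ → ℚ
    cauchy : IsCauchy seq

open ℝ public

infix 4 _≈_ _<ℝ_

_≈_ : ℝ → ℝ → Set
x ≈ y = ∀ ε → 0ℚ ℚ.< ε → Eventually λ n → ℚ.∣ seq x n ℚ.- seq y n ∣ ℚ.< ε

-- Strict order: the gap must be bounded below by one positive rational.
_<ℝ_ : ℝ → ℝ → Set
x <ℝ y = ∃ λ ε → 0ℚ ℚ.< ε × Eventually λ n → seq x n ℚ.+ ε ℚ.< seq y n

∣p-p∣<ε : ∀ p {ε} → 0ℚ ℚ.< ε → ℚ.∣ p ℚ.- p ∣ ℚ.< ε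
∣p-p∣<ε p {ε} 0<ε =
  subst (λ d → ℚ.∣ d ∣ ℚ.< ε) (sym (ℚ.+-inverseʳ p)) 0<ε

half>0 : ∀ {ε} → 0ℚ ℚ.< ε → 0ℚ ℚ.< ½ ℚ.* ε
half>0 {ε} 0<ε =
  subst (ℚ._< ½ ℚ.* ε) (ℚ.*-zeroʳ ½) (ℚ.*-monoʳ-<-pos ½ 0<ε)

half+half : ∀ ε → ½ ℚ.* ε ℚ.+ ½ ℚ.* ε ≡ ε
half+half ε =
  trans (sym (ℚ.*-distribʳ-+ ε ½ ½)) (ℚ.*-identityˡ ε)

+-regroup : ∀ a b c d →
  (a ℚ.+ b) ℚ.- (c ℚ.+ d) ≡ (a ℚ.- c) ℚ.+ (b ℚ.- d)
+-regroup = solve 4 (λ a b c d →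
  (a :+ b) :- (c :+ d) := (a :- c) :+ (b :- d)) refl
  where open +-*-Solver

*-regroup : ∀ a b c d →
  a ℚ.* b ℚ.- c ℚ.* d ≡ a ℚ.* (b ℚ.- d) ℚ.+ d ℚ.* (a ℚ.- c)
*-regroup = solve 4 (λ a b c d →
  a :* b :- c :* d := a :* (b :- d) :+ d :* (a :- c)) refl
  where open +-*-Solver

neg-regroup : ∀ a b → (ℚ.- a) ℚ.- (ℚ.- b) ≡ ℚ.- (a ℚ.- b)
neg-regroup = solve 2 (λ a b → (:- a) :- (:- b) := :- (a :- b)) refl
  where open +-*-Solver

split : ∀ a b → a ≡ b ℚ.+ (a ℚ.- b)
split = solve 2 (λ a b → a := b :+ (a :- b)) refl
  where open +-*-Solver

+-cauchy : ∀ x y → IsCauchy x → IsCauchy y →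
           IsCauchy (λ n → x n ℚ.+ y n)
+-cauchy x y cx cy ε 0<ε
  with cx (½ ℚ.* ε) (half>0 0<ε) | cy (½ ℚ.* ε) (half>0 0<ε)
... | M , px | N , py = M ℕ.⊔ N , λ m n m≥ n≥ → begin-strict
  ℚ.∣ (x m ℚ.+ y m) ℚ.- (x n ℚ.+ y n) ∣
    ≡⟨ cong ℚ.∣_∣ (+-regroup (x m) (y m) (x n) (y n)) ⟩
  ℚ.∣ (x m ℚ.- x n) ℚ.+ (y m ℚ.- y n) ∣
    ≤⟨ ℚ.∣p+q∣≤∣p∣+∣q∣ (x m ℚ.- x n) (y m ℚ.- y n) ⟩
  ℚ.∣ x m ℚ.- x n ∣ ℚ.+ ℚ.∣ y m ℚ.- y n ∣
    <⟨ ℚ.+-mono-< (px m n (ℕ.m⊔n≤o⇒m≤o M N m≥) (ℕ.m⊔n≤o⇒m≤o M N n≥))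
                  (py m n (ℕ.m⊔n≤o⇒n≤o M N m≥) (ℕ.m⊔n≤o⇒n≤o M N n≥)) ⟩
  ½ ℚ.* ε ℚ.+ ½ ℚ.* ε
    ≡⟨ half+half ε ⟩
  ε ∎
  where open ℚ.≤-Reasoning

neg-cauchy : ∀ x → IsCauchy x → IsCauchy (λ n → ℚ.- x n)
neg-cauchy x cx ε 0<ε with cx ε 0<ε
... | N , px = N , λ m n m≥ n≥ →
  subst (ℚ._< ε)
    (sym (trans (cong ℚ.∣_∣ (neg-regroup (x m) (x n)))
                (ℚ.∣-p∣≡∣p∣ (x m ℚ.- x n))))
    (px m n m≥ n≥)

cauchy⇒bounded : ∀ x → IsCauchy x →
  ∃ λ B → ℚ.Positive B × Eventually λ n → ℚ.∣ x n ∣ ℚ.≤ B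
cauchy⇒bounded x cx with cx 1ℚ (ℚ.positive⁻¹ 1ℚ)
... | N , px = B , ℚ.positive 0<B , N , λ n n≥ → begin
  ℚ.∣ x n ∣
    ≡⟨ cong ℚ.∣_∣ (split (x n) (x N)) ⟩
  ℚ.∣ x N ℚ.+ (x n ℚ.- x N) ∣
    ≤⟨ ℚ.∣p+q∣≤∣p∣+∣q∣ (x N) (x n ℚ.- x N) ⟩
  ℚ.∣ x N ∣ ℚ.+ ℚ.∣ x n ℚ.- x N ∣
    ≤⟨ ℚ.+-monoʳ-≤ ℚ.∣ x N ∣ (ℚ.<⇒≤ (px n N n≥ ℕ.≤-refl)) ⟩
  B ∎
  where
  open ℚ.≤-Reasoning
  B = ℚ.∣ x N ∣ ℚ.+ 1ℚ
  0<B : 0ℚ ℚ.< B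
  0<B = ℚ.+-mono-≤-< (ℚ.0≤∣p∣ (x N)) (ℚ.positive⁻¹ 1ℚ)

-- ε is shared out as B·δ + C·δ with δ = ε/(B + C).
share : ∀ B C ε → ℚ.Positive B → ℚ.Positive C → 0ℚ ℚ.< ε →
        ∃ λ δ → 0ℚ ℚ.< δ × B ℚ.* δ ℚ.+ C ℚ.* δ ≡ ε
share B C ε B>0 C>0 0<ε = go (B ℚ.+ C) refl {{ℚ.pos+pos⇒pos B {{B>0}} C {{C>0}}}}
  where
  go : ∀ D → B ℚ.+ C ≡ D → {{ℚ.Positive D}} →
       ∃ λ δ → 0ℚ ℚ.< δ × B ℚ.* δ ℚ.+ C ℚ.* δ ≡ ε
  go D B+C≡D {{D>0}} = go′ (ℚ.1/ D) (ℚ.*-inverseʳ D) (ℚ.1/pos⇒pos D)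
    where
    instance
      D≢0 : ℚ.NonZero D
      D≢0 = ℚ.pos⇒nonZero D
    go′ : ∀ D⁻¹ → D ℚ.* D⁻¹ ≡ 1ℚ → ℚ.Positive D⁻¹ →
          ∃ λ δ → 0ℚ ℚ.< δ × B ℚ.* δ ℚ.+ C ℚ.* δ ≡ ε
    go′ D⁻¹ D*D⁻¹≡1 D⁻¹>0 = D⁻¹ ℚ.* ε ,
      subst (ℚ._< D⁻¹ ℚ.* ε) (ℚ.*-zeroʳ D⁻¹)
        (ℚ.*-monoʳ-<-pos D⁻¹ {{D⁻¹>0}} 0<ε) ,
      (begin
        B ℚ.* (D⁻¹ ℚ.* ε) ℚ.+ C ℚ.* (D⁻¹ ℚ.* ε)
          ≡⟨ sym (ℚ.*-distribʳ-+ (D⁻¹ ℚ.* ε) B C) ⟩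
        (B ℚ.+ C) ℚ.* (D⁻¹ ℚ.* ε)
          ≡⟨ cong (ℚ._* (D⁻¹ ℚ.* ε)) B+C≡D ⟩
        D ℚ.* (D⁻¹ ℚ.* ε)
          ≡⟨ sym (ℚ.*-assoc D D⁻¹ ε) ⟩
        D ℚ.* D⁻¹ ℚ.* ε
          ≡⟨ cong (ℚ._* ε) D*D⁻¹≡1 ⟩
        1ℚ ℚ.* ε
          ≡⟨ ℚ.*-identityˡ ε ⟩
        ε ∎)
      where open ≡-Reasoning

∣u*v∣<K*δ : ∀ u v K δ → ℚ.Positive K →
            ℚ.∣ u ∣ ℚ.≤ K → ℚ.∣ v ∣ ℚ.< δ → ℚ.∣ u ℚ.* v ∣ ℚ.< K ℚ.* δ
∣u*v∣<K*δ u v K δ K>0 u≤K v<δ = begin-strict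
  ℚ.∣ u ℚ.* v ∣
    ≡⟨ ℚ.∣p*q∣≡∣p∣*∣q∣ u v ⟩
  ℚ.∣ u ∣ ℚ.* ℚ.∣ v ∣
    ≤⟨ ℚ.*-monoʳ-≤-nonNeg ℚ.∣ v ∣ {{ℚ.nonNegative (ℚ.0≤∣p∣ v)}} u≤K ⟩
  K ℚ.* ℚ.∣ v ∣
    <⟨ ℚ.*-monoʳ-<-pos K {{K>0}} v<δ ⟩
  K ℚ.* δ ∎
  where open ℚ.≤-Reasoning

*-close : ∀ a b c d B C δ → ℚ.Positive B → ℚ.Positive C →
          ℚ.∣ a ∣ ℚ.≤ B → ℚ.∣ d ∣ ℚ.≤ C →
          ℚ.∣ a ℚ.- c ∣ ℚ.< δ → ℚ.∣ b ℚ.- d ∣ ℚ.< δ →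
          ℚ.∣ a ℚ.* b ℚ.- c ℚ.* d ∣ ℚ.< B ℚ.* δ ℚ.+ C ℚ.* δ
*-close a b c d B C δ B>0 C>0 a≤B d≤C ac bd = begin-strict
  ℚ.∣ a ℚ.* b ℚ.- c ℚ.* d ∣
    ≡⟨ cong ℚ.∣_∣ (*-regroup a b c d) ⟩
  ℚ.∣ a ℚ.* (b ℚ.- d) ℚ.+ d ℚ.* (a ℚ.- c) ∣
    ≤⟨ ℚ.∣p+q∣≤∣p∣+∣q∣ (a ℚ.* (b ℚ.- d)) (d ℚ.* (a ℚ.- c)) ⟩
  ℚ.∣ a ℚ.* (b ℚ.- d) ∣ ℚ.+ ℚ.∣ d ℚ.* (a ℚ.- c) ∣
    <⟨ ℚ.+-mono-< (∣u*v∣<K*δ a (b ℚ.- d) B δ B>0 a≤B bd)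
                  (∣u*v∣<K*δ d (a ℚ.- c) C δ C>0 d≤C ac) ⟩
  B ℚ.* δ ℚ.+ C ℚ.* δ ∎
  where open ℚ.≤-Reasoning

*-cauchy : ∀ x y → IsCauchy x → IsCauchy y →
           IsCauchy (λ n → x n ℚ.* y n)
*-cauchy x y cx cy ε 0<ε =
  let B , B>0 , M₁ , bx = cauchy⇒bounded x cx
      C , C>0 , N₁ , by = cauchy⇒bounded y cy
      δ , 0<δ , Bδ+Cδ≡ε = share B C ε B>0 C>0 0<ε
      M₂ , px = cx δ 0<δ
      N₂ , py = cy δ 0<δ
  in combine B C δ B>0 C>0 M₁ N₁ M₂ N₂ bx by px py Bδ+Cδ≡ε
  where
  combine : ∀ B C δ → ℚ.Positive B → ℚ.Positive C → ∀ M₁ N₁ M₂ N₂ →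
    (∀ n → M₁ ℕ.≤ n → ℚ.∣ x n ∣ ℚ.≤ B) →
    (∀ n → N₁ ℕ.≤ n → ℚ.∣ y n ∣ ℚ.≤ C) →
    (∀ m n → M₂ ℕ.≤ m → M₂ ℕ.≤ n → ℚ.∣ x m ℚ.- x n ∣ ℚ.< δ) →
    (∀ m n → N₂ ℕ.≤ m → N₂ ℕ.≤ n → ℚ.∣ y m ℚ.- y n ∣ ℚ.< δ) →
    B ℚ.* δ ℚ.+ C ℚ.* δ ≡ ε →
    ∃ λ N → ∀ m n → N ℕ.≤ m → N ℕ.≤ n →
      ℚ.∣ x m ℚ.* y m ℚ.- x n ℚ.* y n ∣ ℚ.< ε
  combine B C δ B>0 C>0 M₁ N₁ M₂ N₂ bx by px py refl =
    (M₁ ℕ.⊔ N₁) ℕ.⊔ (M₂ ℕ.⊔ N₂) , λ m n m≥ n≥ →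
      *-close (x m) (y m) (x n) (y n) B C δ B>0 C>0
        (bx m (ℕ.m⊔n≤o⇒m≤o M₁ N₁ (first m≥)))
        (by n (ℕ.m⊔n≤o⇒n≤o M₁ N₁ (first n≥)))
        (px m n (ℕ.m⊔n≤o⇒m≤o M₂ N₂ (second m≥))
                (ℕ.m⊔n≤o⇒m≤o M₂ N₂ (second n≥)))
        (py m n (ℕ.m⊔n≤o⇒n≤o M₂ N₂ (second m≥))
                (ℕ.m⊔n≤o⇒n≤o M₂ N₂ (second n≥)))
    where
    first : ∀ {o} → (M₁ ℕ.⊔ N₁) ℕ.⊔ (M₂ ℕ.⊔ N₂) ℕ.≤ o → M₁ ℕ.⊔ N₁ ℕ.≤ o
    first = ℕ.m⊔n≤o⇒m≤o (M₁ ℕ.⊔ N₁) (M₂ ℕ.⊔ N₂)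
    second : ∀ {o} → (M₁ ℕ.⊔ N₁) ℕ.⊔ (M₂ ℕ.⊔ N₂) ℕ.≤ o → M₂ ℕ.⊔ N₂ ℕ.≤ o
    second = ℕ.m⊔n≤o⇒n≤o (M₁ ℕ.⊔ N₁) (M₂ ℕ.⊔ N₂)

infixl 6 _+ℝ_ _-ℝ_
infixl 7 _*ℝ_ _/ℝ_

fromℚ : ℚ → ℝ
fromℚ r = mkℝ (λ _ → r) (λ ε 0<ε → 0 , λ _ _ _ _ → ∣p-p∣<ε r 0<ε)

fromℤ : ℤ → ℝ
fromℤ z = fromℚ (z ℚ./ 1)

0ℝ 1ℝ : ℝ
0ℝ = fromℤ 0ℤ
1ℝ = fromℤ 1ℤ

_+ℝ_ _-ℝ_ _*ℝ_ : ℝ → ℝ → ℝ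
x +ℝ y = mkℝ (λ n → seq x n ℚ.+ seq y n)
  (+-cauchy (seq x) (seq y) (cauchy x) (cauchy y))
x -ℝ y = mkℝ (λ n → seq x n ℚ.- seq y n)
  (+-cauchy (seq x) (λ n → ℚ.- seq y n) (cauchy x)
            (neg-cauchy (seq y) (cauchy y)))
x *ℝ y = mkℝ (λ n → seq x n ℚ.* seq y n)
  (*-cauchy (seq x) (seq y) (cauchy x) (cauchy y))

-- Division by a nonzero integer Q; the rational below is 1/Q.
_/ℝ_ : ℝ → (Q : ℤ) .{{_ : ℤ.NonZero Q}} → ℝ
x /ℝ Q = x *ℝ fromℚ ((ℤ.sign Q ℤ.◃ 1) ℚ./ ℤ.∣ Q ∣)

Irrational : ℝ → Set
Irrational x = ∀ (r : ℚ) → ¬ (x ≈ fromℚ r)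

------------------------------------------------------------------------
-- Continued fractions

-- α ≈[ a₀ ∷ … ∷ aⱼ₋₁ ∷ [] ⨾ β ] says that [a₀,…,aⱼ₋₁,β] is defined and
-- equals α.  It is a relation because 1/γ exists only for invertible γ;
-- in the second constructor γ⁻¹ is that inverse, so α = a + 1/γ.
data _≈[_⨾_] (α : ℝ) : List ℤ → ℝ → Set where
  last : ∀ {β} → α ≈ β → α ≈[ [] ⨾ β ]
  step : ∀ {a as β} (γ γ⁻¹ : ℝ) → γ *ℝ γ⁻¹ ≈ 1ℝ →
         α ≈ fromℤ a +ℝ γ⁻¹ → γ ≈[ as ⨾ β ] → α ≈[ a ∷ as ⨾ β ]

-- α = [a₀,…,aⱼ₋₁,β] with β > 1.  When a₁,…,aⱼ₋₁ are positive, every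
-- tail [aᵢ,…,aⱼ₋₁,β] with i ≥ 1 exceeds 1, so each aᵢ is the integer
-- part of its tail: the regular expansion of α commences a₀,…,aⱼ₋₁, and
-- β is the complete quotient following aⱼ₋₁.
_commences[_⨾_] : ℝ → List ℤ → ℝ → Set
α commences[ as ⨾ β ] = α ≈[ as ⨾ β ] × 1ℝ <ℝ β

------------------------------------------------------------------------
-- 2 × 2 integer matrices, written row by row

record Matrix₂ : Set where
  constructor mat
  field
    e₁₁ e₁₂ e₂₁ e₂₂ : ℤ

infixl 7 _⊗_

_⊗_ : Matrix₂ → Matrix₂ → Matrix₂
mat a b c d ⊗ mat a′ b′ c′ d′ =
  mat (a ℤ.* a′ ℤ.+ b ℤ.* c′) (a ℤ.* b′ ℤ.+ b ℤ.* d′)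
      (c ℤ.* a′ ℤ.+ d ℤ.* c′) (c ℤ.* b′ ℤ.+ d ℤ.* d′)

cfMatrix : ∀ {h} → Vec ℤ h → Matrix₂
cfMatrix []       = mat 1ℤ 0ℤ 0ℤ 1ℤ
cfMatrix (a ∷ as) = mat a 1ℤ 1ℤ 0ℤ ⊗ cfMatrix as

------------------------------------------------------------------------
-- Integer polynomials in X, Y of total degree at most 2

record Poly₂ : Set where
  field
    cXX cXY cYY cX cY c₁ : ℤ

eval : Poly₂ → ℤ → ℤ → ℤ
eval F x y =
  cXX * x * x + cXY * x * y + cYY * y * y + cX * x + cY * y + c₁
  where
  open Poly₂ F
  open import Data.Integer.Base using (_+_; _*_)

IsQuadratic : Poly₂ → Set
IsQuadratic F = cXX ≢ 0ℤ ⊎ cXY ≢ 0ℤ ⊎ cYY ≢ 0ℤ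
  where open Poly₂ F

{-# OPTIONS --safe #-}

-- Writing ω - A = (q β + q′)/(p β + p′) with β = (ω + P)/Q, clearing
-- denominators and using ω² = t ω - n gives an equation u ω + v = 0 with integer
-- u, v.  As ω is irrational, u = v = 0, that is
--   q + k p = p′ Q   and   p N + q (A + P) + q′ Q = 0.
-- With p q′ - p′ q = (-1)ʰ, all the relations follow for
--   K₁ = q′ T - p′ N,  K₂ = K₁ + k q′,  L = q′ Q - k q;
-- this K₁ comes from inverting the 2 × 2 system for T and N.
module Submission where

open import Defs
open import Data.Integer using (ℤ; +_; 0ℤ; -1ℤ; _+_; _*_; _-_; -_; _^_; _<_; NonZero)
open import Data.List.Base using (_∷_)
open import Data.Nat.Base as ℕ using (ℕ; suc)
open import Data.Product using (∃; _×_)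
open import Data.Vec.Base using (Vec; toList)
open import Data.Vec.Relation.Unary.All using (All)
open import Relation.Binary.PropositionalEquality using (_≡_)

open import Data.Integer using (1ℤ; -[1+_]; +[1+_]; ∣_∣; sign; _◃_)
import Data.Integer.Properties as ℤ
open import Data.Integer.Tactic.RingSolver using (solve; solve-∀)
open import Data.List.Base using (List; [])
import Data.Nat.Properties as ℕ
open import Data.Product using (_,_)
open import Data.Rational as ℚ using (ℚ; 0ℚ; 1ℚ; _/_)
import Data.Rational.Properties as ℚ
open import Data.Rational.Unnormalised as ℚᵘ using (mkℚᵘ; *≡*)
import Data.Rational.Unnormalised.Properties as ℚᵘ
open import Data.Sum.Base using (inj₁; inj₂; [_,_]′)
open import Data.Vec.Base using ([]; _∷_)
open import Function.Base using (_∘_; id)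
open import Level using (0ℓ)
open import Relation.Binary.Definitions using (tri<; tri≈; tri>)
open import Relation.Binary.PropositionalEquality
  using (_≢_; refl; sym; trans; cong; cong₂; subst; module ≡-Reasoning)
open import Relation.Nullary using (yes; no; contradiction)
open import Relation.Nullary.Decidable.Core using (dec⇒maybe)
import Tactic.RingSolver as RingSolver
open import Tactic.RingSolver.Core.AlmostCommutativeRing
  using (AlmostCommutativeRing; fromCommutativeRing)

-- Null sequences of rationals

ring-ℚ : AlmostCommutativeRing 0ℓ 0ℓ
ring-ℚ = fromCommutativeRing ℚ.+-*-commutativeRing
  λ r → dec⇒maybe (0ℚ ℚ.≟ r)

-- `x ≈ y` unfolds to `Null` of the termwise difference, so equations between reals can be handled
-- by ring identities between rational terms.
Null : (ℕ → ℚ) → Set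
Null f = ∀ ε → 0ℚ ℚ.< ε → Eventually λ n → ℚ.∣ f n ∣ ℚ.< ε

null-resp : ∀ {f g} → (∀ n → f n ≡ g n) → Null f → Null g
null-resp f≡g f→0 ε 0<ε =
  let N , small = f→0 ε 0<ε
  in N , λ n n≥ → subst (λ r → ℚ.∣ r ∣ ℚ.< ε) (f≡g n) (small n n≥)

null-neg : ∀ {f} → Null f → Null (λ n → ℚ.- f n)
null-neg {f} f→0 ε 0<ε =
  let N , small = f→0 ε 0<ε
  in N , λ n n≥ → subst (ℚ._< ε) (sym (ℚ.∣-p∣≡∣p∣ (f n))) (small n n≥)

null-+ : ∀ {f g} → Null f → Null g → Null (λ n → f n ℚ.+ g n)
null-+ {f} {g} f→0 g→0 ε 0<ε =
  let M , f-small = f→0 (ℚ.½ ℚ.* ε) (half>0 0<ε)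
      N , g-small = g→0 (ℚ.½ ℚ.* ε) (half>0 0<ε)
  in M ℕ.⊔ N , λ n n≥ → begin-strict
    ℚ.∣ f n ℚ.+ g n ∣
      ≤⟨ ℚ.∣p+q∣≤∣p∣+∣q∣ (f n) (g n) ⟩
    ℚ.∣ f n ∣ ℚ.+ ℚ.∣ g n ∣
      <⟨ ℚ.+-mono-< (f-small n (ℕ.m⊔n≤o⇒m≤o M N n≥))
                    (g-small n (ℕ.m⊔n≤o⇒n≤o M N n≥)) ⟩
    ℚ.½ ℚ.* ε ℚ.+ ℚ.½ ℚ.* ε
      ≡⟨ half+half ε ⟩
    ε ∎
  where open ℚ.≤-Reasoning

null-- : ∀ {f g} → Null f → Null g → Null (λ n → f n ℚ.- g n)
null-- f→0 g→0 = null-+ f→0 (null-neg g→0)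

-- Cauchy sequences are bounded. Taking the factor as a real allows cofactors to be built with the
-- real operations, which carry their Cauchy proofs.
null-* : ∀ (x : ℝ) {f} → Null f → Null (λ n → seq x n ℚ.* f n)
null-* x {f} f→0 ε 0<ε =
  let B , B>0 , M , bound = cauchy⇒bounded (seq x) (cauchy x)
      -- Equal shares give δ = ε/(2B), so that Bδ lies strictly below ε.
      δ , 0<δ , 2Bδ≡ε = share B B ε B>0 B>0 0<ε
      N , small = f→0 δ 0<δ
      instance _ = B>0
      0<Bδ = subst (ℚ._< B ℚ.* δ) (ℚ.*-zeroʳ B) (ℚ.*-monoʳ-<-pos B 0<δ)
  in M ℕ.⊔ N , λ n n≥ → begin-strict
    ℚ.∣ seq x n ℚ.* f n ∣
      <⟨ ∣u*v∣<K*δ (seq x n) (f n) B δ B>0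
           (bound n (ℕ.m⊔n≤o⇒m≤o M N n≥)) (small n (ℕ.m⊔n≤o⇒n≤o M N n≥)) ⟩
    B ℚ.* δ
      ≡⟨ sym (ℚ.+-identityʳ (B ℚ.* δ)) ⟩
    B ℚ.* δ ℚ.+ 0ℚ
      <⟨ ℚ.+-monoʳ-< (B ℚ.* δ) 0<Bδ ⟩
    B ℚ.* δ ℚ.+ B ℚ.* δ
      ≡⟨ 2Bδ≡ε ⟩
    ε ∎
  where open ℚ.≤-Reasoning

null-const⇒≡0 : ∀ r → Null (λ _ → r) → r ≡ 0ℚ
null-const⇒≡0 r r→0 with r ℚ.≟ 0ℚ
... | yes r≡0 = r≡0
... | no r≢0 =
  let N , small = r→0 ℚ.∣ r ∣ 0<∣r∣
  in contradiction (small N ℕ.≤-refl) (ℚ.<-irrefl refl)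
  where
  0<∣r∣ : 0ℚ ℚ.< ℚ.∣ r ∣
  0<∣r∣ with ℚ.<-cmp 0ℚ ℚ.∣ r ∣
  ... | tri< 0<∣r∣ _ _ = 0<∣r∣
  ... | tri≈ _ 0≡∣r∣ _ = contradiction (ℚ.∣p∣≡0⇒p≡0 r (sym 0≡∣r∣)) r≢0
  ... | tri> _ _ ∣r∣<0 = contradiction (ℚ.≤-<-trans (ℚ.0≤∣p∣ r) ∣r∣<0) (ℚ.<-irrefl refl)

-- If u were nonzero, multiplying by 1/u would give `x` ≈ -v/u, a rational. Once u = 0, the constant
-- v tends to 0 and so is 0.
irrational⇒independent : ∀ x → Irrational x → ∀ u v →
  Null (λ n → u ℚ.* seq x n ℚ.+ v) → u ≡ 0ℚ × v ≡ 0ℚ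
irrational⇒independent x irr u v ux+v→0 with u ℚ.≟ 0ℚ
... | yes refl = refl , null-const⇒≡0 v
  (null-resp (λ n → trans (cong (ℚ._+ v) (ℚ.*-zeroˡ (seq x n))) (ℚ.+-identityˡ v))
             ux+v→0)
... | no u≢0 = contradiction
  (null-resp divide (null-* (fromℚ (ℚ.1/ u)) ux+v→0))
  (irr (ℚ.- (ℚ.1/ u ℚ.* v)))
  where
  instance _ = ℚ.≢-nonZero u≢0
  regroup : ∀ i u x v → i ℚ.* (u ℚ.* x ℚ.+ v) ≡ (i ℚ.* u) ℚ.* x ℚ.- ℚ.- (i ℚ.* v)
  regroup = RingSolver.solve-∀ ring-ℚ

  divide : ∀ n → ℚ.1/ u ℚ.* (u ℚ.* seq x n ℚ.+ v) ≡
                 seq x n ℚ.- ℚ.- (ℚ.1/ u ℚ.* v)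
  divide n = begin
    ℚ.1/ u ℚ.* (u ℚ.* seq x n ℚ.+ v)
      ≡⟨ regroup (ℚ.1/ u) u (seq x n) v ⟩
    (ℚ.1/ u ℚ.* u) ℚ.* seq x n ℚ.- ℚ.- (ℚ.1/ u ℚ.* v)
      ≡⟨ cong (λ r → r ℚ.* seq x n ℚ.- ℚ.- (ℚ.1/ u ℚ.* v)) (ℚ.*-inverseˡ u) ⟩
    1ℚ ℚ.* seq x n ℚ.- ℚ.- (ℚ.1/ u ℚ.* v)
      ≡⟨ cong (ℚ._- ℚ.- (ℚ.1/ u ℚ.* v)) (ℚ.*-identityˡ (seq x n)) ⟩
    seq x n ℚ.- ℚ.- (ℚ.1/ u ℚ.* v) ∎
    where open ≡-Reasoning

-- The integers inside the rationals

-- The constant term of the sequence of `fromℤ z`, to which `seq (fromℤ z) n` unfolds.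
ι : ℤ → ℚ
ι z = z / 1

-- As `_/_` reduces to lowest terms, the homomorphism laws are checked on unnormalised fractions.
ι-+ : ∀ x y → ι (x + y) ≡ ι x ℚ.+ ι y
ι-+ x y = ℚ.toℚᵘ-injective (begin-equality
  ℚ.toℚᵘ (ι (x + y))              ≃⟨ ℚ.toℚᵘ-fromℚᵘ (mkℚᵘ (x + y) 0) ⟩
  mkℚᵘ (x + y) 0                  ≃⟨ *≡* (cong (_* 1ℤ)
    (sym (cong₂ _+_ (ℤ.*-identityʳ x) (ℤ.*-identityʳ y)))) ⟩
  mkℚᵘ x 0 ℚᵘ.+ mkℚᵘ y 0          ≃⟨ ℚᵘ.≃-sym (ℚᵘ.+-cong
    (ℚ.toℚᵘ-fromℚᵘ (mkℚᵘ x 0)) (ℚ.toℚᵘ-fromℚᵘ (mkℚᵘ y 0))) ⟩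
  ℚ.toℚᵘ (ι x) ℚᵘ.+ ℚ.toℚᵘ (ι y)  ≃⟨ ℚᵘ.≃-sym (ℚ.toℚᵘ-homo-+ (ι x) (ι y)) ⟩
  ℚ.toℚᵘ (ι x ℚ.+ ι y)            ∎)
  where open ℚᵘ.≤-Reasoning

ι-* : ∀ x y → ι (x * y) ≡ ι x ℚ.* ι y
ι-* x y = ℚ.toℚᵘ-injective (begin-equality
  ℚ.toℚᵘ (ι (x * y))              ≃⟨ ℚ.toℚᵘ-fromℚᵘ (mkℚᵘ (x * y) 0) ⟩
  mkℚᵘ x 0 ℚᵘ.* mkℚᵘ y 0          ≃⟨ ℚᵘ.≃-sym (ℚᵘ.*-cong
    (ℚ.toℚᵘ-fromℚᵘ (mkℚᵘ x 0)) (ℚ.toℚᵘ-fromℚᵘ (mkℚᵘ y 0))) ⟩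
  ℚ.toℚᵘ (ι x) ℚᵘ.* ℚ.toℚᵘ (ι y)  ≃⟨ ℚᵘ.≃-sym (ℚ.toℚᵘ-homo-* (ι x) (ι y)) ⟩
  ℚ.toℚᵘ (ι x ℚ.* ι y)            ∎)
  where open ℚᵘ.≤-Reasoning

ι-neg : ∀ x → ι (- x) ≡ ℚ.- ι x
ι-neg x = ℚ.toℚᵘ-injective (begin-equality
  ℚ.toℚᵘ (ι (- x))     ≃⟨ ℚ.toℚᵘ-fromℚᵘ (mkℚᵘ (- x) 0) ⟩
  ℚᵘ.- mkℚᵘ x 0        ≃⟨ ℚᵘ.≃-sym (ℚᵘ.-‿cong (ℚ.toℚᵘ-fromℚᵘ (mkℚᵘ x 0))) ⟩
  ℚᵘ.- ℚ.toℚᵘ (ι x)    ≃⟨ ℚᵘ.≃-sym (ℚ.toℚᵘ-homo‿- (ι x)) ⟩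
  ℚ.toℚᵘ (ℚ.- ι x)     ∎)
  where open ℚᵘ.≤-Reasoning

ι-- : ∀ x y → ι (x - y) ≡ ι x ℚ.- ι y
ι-- x y = trans (ι-+ x (- y)) (cong (ι x ℚ.+_) (ι-neg y))

ι≡0⇒≡0 : ∀ x → ι x ≡ 0ℚ → x ≡ 0ℤ
ι≡0⇒≡0 x ιx≡0 with ℚ.fromℚᵘ-injective {mkℚᵘ x 0} {mkℚᵘ 0ℤ 0} ιx≡0
... | *≡* x*1≡0 = trans (sym (ℤ.*-identityʳ x)) x*1≡0

ι-combination : ∀ a x b y → ι (a * x + b * y) ≡ ι a ℚ.* ι x ℚ.+ ι b ℚ.* ι y
ι-combination a x b y =
  trans (ι-+ (a * x) (b * y)) (cong₂ ℚ._+_ (ι-* a x) (ι-* b y))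

-- The constant by which _/ℝ Q multiplies.
recip : (Q : ℤ) .{{_ : NonZero Q}} → ℚ
recip Q = (sign Q ◃ 1) / ∣ Q ∣

recip-inverse : ∀ Q .{{_ : NonZero Q}} → recip Q ℚ.* ι Q ≡ 1ℚ
recip-inverse Q = ℚ.toℚᵘ-injective (begin-equality
  ℚ.toℚᵘ (recip Q ℚ.* ι Q)              ≃⟨ ℚ.toℚᵘ-homo-* (recip Q) (ι Q) ⟩
  ℚ.toℚᵘ (recip Q) ℚᵘ.* ℚ.toℚᵘ (ι Q)    ≃⟨ product Q ⟩
  ℚ.toℚᵘ 1ℚ                             ∎)
  where
  open ℚᵘ.≤-Reasoning
  -- Splitting on the sign of `Q` lets `sign Q ◃ 1` and `∣ Q ∣` compute.
  product : ∀ Q .{{_ : NonZero Q}} →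
            ℚ.toℚᵘ (recip Q) ℚᵘ.* ℚ.toℚᵘ (ι Q) ℚᵘ.≃ ℚ.toℚᵘ 1ℚ
  product Q@(+[1+ m ]) = ℚᵘ.≃-trans
    (ℚᵘ.*-cong (ℚ.toℚᵘ-fromℚᵘ (mkℚᵘ 1ℤ m)) (ℚ.toℚᵘ-fromℚᵘ (mkℚᵘ Q 0)))
    (*≡* (trans (ℤ.*-identityʳ (1ℤ * Q))
                (cong (λ d → 1ℤ * +[1+ d ]) (sym (ℕ.*-identityʳ m)))))
  product Q@(-[1+ m ]) = ℚᵘ.≃-trans
    (ℚᵘ.*-cong (ℚ.toℚᵘ-fromℚᵘ (mkℚᵘ -1ℤ m)) (ℚ.toℚᵘ-fromℚᵘ (mkℚᵘ Q 0)))
    (*≡* (trans (ℤ.*-identityʳ (-1ℤ * Q))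
                (cong (λ d → 1ℤ * +[1+ d ]) (sym (ℕ.*-identityʳ m)))))

-- Continued fractions as Möbius transformations

-- α = (p β + p′) / (q β + q′), with the denominator cleared.
Möbius : (p p′ q q′ : ℚ) → ℝ → ℝ → Set
Möbius p p′ q q′ α β = Null λ n →
  seq α n ℚ.* (q ℚ.* seq β n ℚ.+ q′) ℚ.- (p ℚ.* seq β n ℚ.+ p′)

-- Prepending `a` multiplies the coefficient matrix on the left by (a 1; 1 0). The new residual
-- combines those of the three hypotheses with cofactors pβ + p′, qβ + q′ and -γ⁻¹, so qβ + q′ need
-- not be inverted.
möbius-step : ∀ α β γ γ⁻¹ a p p′ q q′ → γ *ℝ γ⁻¹ ≈ 1ℝ → α ≈ fromℤ a +ℝ γ⁻¹ →
  Möbius p p′ q q′ γ β →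
  Möbius (ι a ℚ.* p ℚ.+ q) (ι a ℚ.* p′ ℚ.+ q′) p p′ α β
möbius-step α β γ γ⁻¹ a p p′ q q′ γγ⁻¹≈1 α≈a+γ⁻¹ γ-eq =
  null-resp (λ n → regroup (ι a) p p′ q q′ (seq α n) (seq β n) (seq γ n) (seq γ⁻¹ n))
    (null-+ (null-* (fromℚ p *ℝ β +ℝ fromℚ p′) α≈a+γ⁻¹)
            (null-- (null-* (fromℚ q *ℝ β +ℝ fromℚ q′) γγ⁻¹≈1)
                    (null-* γ⁻¹ γ-eq)))
  where
  regroup : ∀ a p p′ q q′ x b g i →
    (p ℚ.* b ℚ.+ p′) ℚ.* (x ℚ.- (a ℚ.+ i)) ℚ.+
    ((q ℚ.* b ℚ.+ q′) ℚ.* (g ℚ.* i ℚ.- 1ℚ) ℚ.-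
     i ℚ.* (g ℚ.* (q ℚ.* b ℚ.+ q′) ℚ.- (p ℚ.* b ℚ.+ p′))) ≡
    x ℚ.* (p ℚ.* b ℚ.+ p′) ℚ.-
    ((a ℚ.* p ℚ.+ q) ℚ.* b ℚ.+ (a ℚ.* p′ ℚ.+ q′))
  regroup = RingSolver.solve-∀ ring-ℚ

Möbiusℤ : Matrix₂ → ℝ → ℝ → Set
Möbiusℤ (mat p p′ q q′) = Möbius (ι p) (ι p′) (ι q) (ι q′)

cf⇒möbius : ∀ {h α β} (a : Vec ℤ h) → α ≈[ toList a ⨾ β ] → Möbiusℤ (cfMatrix a) α β
cf⇒möbius {α = α} {β} [] (last α≈β) =
  null-resp (λ n → pad (seq α n) (seq β n)) α≈β
  where
  pad : ∀ x b → x ℚ.- b ≡ x ℚ.* (0ℚ ℚ.* b ℚ.+ 1ℚ) ℚ.- (1ℚ ℚ.* b ℚ.+ 0ℚ)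
  pad = RingSolver.solve-∀ ring-ℚ
cf⇒möbius {α = α} {β} (a ∷ as) (step γ γ⁻¹ γγ⁻¹≈1 α≈a+γ⁻¹ γ-cf)
  with cfMatrix as | cf⇒möbius as γ-cf
... | mat p p′ q q′ | γ-eq
  -- The entries of the matrix product keep explicit factors 1 and 0; `pad` inserts them into the
  -- equation of `möbius-step`.
  rewrite ι-combination a p 1ℤ q | ι-combination a p′ 1ℤ q′
        | ι-combination 1ℤ p 0ℤ q | ι-combination 1ℤ p′ 0ℤ q′ =
  null-resp
    (λ n → pad (ι a) (ι p) (ι p′) (ι q) (ι q′) (seq α n) (seq β n))
    (möbius-step α β γ γ⁻¹ a (ι p) (ι p′) (ι q) (ι q′) γγ⁻¹≈1 α≈a+γ⁻¹ γ-eq)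
  where
  pad : ∀ a p p′ q q′ x b →
    x ℚ.* (p ℚ.* b ℚ.+ p′) ℚ.- ((a ℚ.* p ℚ.+ q) ℚ.* b ℚ.+ (a ℚ.* p′ ℚ.+ q′)) ≡
    x ℚ.* ((1ℚ ℚ.* p ℚ.+ 0ℚ ℚ.* q) ℚ.* b ℚ.+ (1ℚ ℚ.* p′ ℚ.+ 0ℚ ℚ.* q′)) ℚ.-
    ((a ℚ.* p ℚ.+ 1ℚ ℚ.* q) ℚ.* b ℚ.+ (a ℚ.* p′ ℚ.+ 1ℚ ℚ.* q′))
  pad = RingSolver.solve-∀ ring-ℚ

-- The linear equation for ω

-- Here `i` stands for 1/Q and `w` for a term of ω. The relation i Q = 1 is not a ring identity, so
-- the product `i * Q` is first brought together for `eliminate` to replace.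
isolate : ∀ i Q p p′ q q′ A P t n w →
  Q ℚ.* (w ℚ.* (p ℚ.* ((w ℚ.+ P) ℚ.* i) ℚ.+ p′) ℚ.-
         ((A ℚ.* p ℚ.+ q) ℚ.* ((w ℚ.+ P) ℚ.* i) ℚ.+ (A ℚ.* p′ ℚ.+ q′))) ℚ.-
  p ℚ.* (w ℚ.* w ℚ.- t ℚ.* w ℚ.+ n ℚ.- 0ℚ) ≡
  (i ℚ.* Q) ℚ.* ((w ℚ.* p ℚ.- (A ℚ.* p ℚ.+ q)) ℚ.* (w ℚ.+ P)) ℚ.+
  (w ℚ.* (p′ ℚ.* Q) ℚ.- (A ℚ.* p′ ℚ.+ q′) ℚ.* Q ℚ.-
   p ℚ.* (w ℚ.* w ℚ.- t ℚ.* w ℚ.+ n))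
isolate = RingSolver.solve-∀ ring-ℚ

-- The term p w² cancels against p times the minimal polynomial, which leaves an expression linear
-- in `w`.
collect : ∀ Q p p′ q q′ A P t n w →
  1ℚ ℚ.* ((w ℚ.* p ℚ.- (A ℚ.* p ℚ.+ q)) ℚ.* (w ℚ.+ P)) ℚ.+
  (w ℚ.* (p′ ℚ.* Q) ℚ.- (A ℚ.* p′ ℚ.+ q′) ℚ.* Q ℚ.-
   p ℚ.* (w ℚ.* w ℚ.- t ℚ.* w ℚ.+ n)) ≡
  (p ℚ.* (t ℚ.+ P ℚ.- A) ℚ.+ p′ ℚ.* Q ℚ.- q) ℚ.* w ℚ.+
  (ℚ.- ((A ℚ.* p ℚ.+ q) ℚ.* P ℚ.+ (A ℚ.* p′ ℚ.+ q′) ℚ.* Q ℚ.+ p ℚ.* n))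
collect = RingSolver.solve-∀ ring-ℚ

eliminate : ∀ i Q → i ℚ.* Q ≡ 1ℚ → ∀ p p′ q q′ A P t n w →
  Q ℚ.* (w ℚ.* (p ℚ.* ((w ℚ.+ P) ℚ.* i) ℚ.+ p′) ℚ.-
         ((A ℚ.* p ℚ.+ q) ℚ.* ((w ℚ.+ P) ℚ.* i) ℚ.+ (A ℚ.* p′ ℚ.+ q′))) ℚ.-
  p ℚ.* (w ℚ.* w ℚ.- t ℚ.* w ℚ.+ n ℚ.- 0ℚ) ≡
  (p ℚ.* (t ℚ.+ P ℚ.- A) ℚ.+ p′ ℚ.* Q ℚ.- q) ℚ.* w ℚ.+
  (ℚ.- ((A ℚ.* p ℚ.+ q) ℚ.* P ℚ.+ (A ℚ.* p′ ℚ.+ q′) ℚ.* Q ℚ.+ p ℚ.* n))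
eliminate i Q iQ≡1 p p′ q q′ A P t n w = trans
  (trans (isolate i Q p p′ q q′ A P t n w)
         (cong (λ r → r ℚ.* ((w ℚ.* p ℚ.- (A ℚ.* p ℚ.+ q)) ℚ.* (w ℚ.+ P)) ℚ.+
                      (w ℚ.* (p′ ℚ.* Q) ℚ.- (A ℚ.* p′ ℚ.+ q′) ℚ.* Q ℚ.-
                       p ℚ.* (w ℚ.* w ℚ.- t ℚ.* w ℚ.+ n))) iQ≡1))
  (collect Q p p′ q q′ A P t n w)

linear-equation : ∀ ω β i Q → i ℚ.* Q ≡ 1ℚ → ∀ A P t n p p′ q q′ →
  (∀ m → (seq ω m ℚ.+ P) ℚ.* i ≡ seq β m) →
  Null (λ m → seq ω m ℚ.* seq ω m ℚ.- t ℚ.* seq ω m ℚ.+ n ℚ.- 0ℚ) →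
  Möbius (A ℚ.* p ℚ.+ q) (A ℚ.* p′ ℚ.+ q′) p p′ ω β →
  Null (λ m → (p ℚ.* (t ℚ.+ P ℚ.- A) ℚ.+ p′ ℚ.* Q ℚ.- q) ℚ.* seq ω m ℚ.+
    (ℚ.- ((A ℚ.* p ℚ.+ q) ℚ.* P ℚ.+ (A ℚ.* p′ ℚ.+ q′) ℚ.* Q ℚ.+ p ℚ.* n)))
linear-equation ω β i Q iQ≡1 A P t n p p′ q q′ β≡ minpoly möbius =
  null-resp
    (λ m → trans
      (cong (λ b → Q ℚ.* (seq ω m ℚ.* (p ℚ.* b ℚ.+ p′) ℚ.-
                          ((A ℚ.* p ℚ.+ q) ℚ.* b ℚ.+ (A ℚ.* p′ ℚ.+ q′))) ℚ.-
                   p ℚ.* (seq ω m ℚ.* seq ω m ℚ.- t ℚ.* seq ω m ℚ.+ n ℚ.- 0ℚ))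
            (sym (β≡ m)))
      (eliminate i Q iQ≡1 p p′ q q′ A P t n (seq ω m)))
    (null-- (null-* (fromℚ Q) möbius) (null-* (fromℚ p) minpoly))

ι-ω-coefficient : ∀ A P Q t p p′ q →
  ι (p * (t + P - A) + p′ * Q - q) ≡
  ι p ℚ.* (ι t ℚ.+ ι P ℚ.- ι A) ℚ.+ ι p′ ℚ.* ι Q ℚ.- ι q
ι-ω-coefficient A P Q t p p′ q
  rewrite ι-- (p * (t + P - A) + p′ * Q) q | ι-combination p (t + P - A) p′ Q
        | ι-- (t + P) A | ι-+ t P = refl

ι-constant-term : ∀ A P Q n p p′ q q′ →
  ι ((A * p + q) * P + (A * p′ + q′) * Q + p * n) ≡
  (ι A ℚ.* ι p ℚ.+ ι q) ℚ.* ι P ℚ.+ (ι A ℚ.* ι p′ ℚ.+ ι q′) ℚ.* ι Q ℚ.+ ι p ℚ.* ι n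
ι-constant-term A P Q n p p′ q q′
  rewrite ι-+ ((A * p + q) * P + (A * p′ + q′) * Q) (p * n)
        | ι-combination (A * p + q) P (A * p′ + q′) Q
        | ι-+ (A * p) q | ι-+ (A * p′) q′ | ι-* A p | ι-* A p′ | ι-* p n = refl

-- `cfMatrix a` covers only a₁,...,aₕ, so `A` is prepended by a separate `möbius-step`.
-- Irrationality of ω then kills both coefficients of the linear equation.
coefficients-vanish : ∀ {h} (a : Vec ℤ h) t n ω → Irrational ω →
  (ω *ℝ ω) -ℝ (fromℤ t *ℝ ω) +ℝ fromℤ n ≈ 0ℝ →
  ∀ A P Q .{{_ : NonZero Q}} →
  ω ≈[ A ∷ toList a ⨾ (ω +ℝ fromℤ P) /ℝ Q ] →
  ∀ p p′ q q′ → cfMatrix a ≡ mat p p′ q q′ →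
  p * (t + P - A) + p′ * Q - q ≡ 0ℤ ×
  (A * p + q) * P + (A * p′ + q′) * Q + p * n ≡ 0ℤ
coefficients-vanish a t n ω irr minpoly A P Q (step γ γ⁻¹ γγ⁻¹≈1 ω≈A+γ⁻¹ γ-cf)
  p p′ q q′ a≡ =
  let u≡0 , -v≡0 = irrational⇒independent ω irr _ _
        (linear-equation ω ((ω +ℝ fromℤ P) /ℝ Q) (recip Q) (ι Q) (recip-inverse Q)
          (ι A) (ι P) (ι t) (ι n) (ι p) (ι p′) (ι q) (ι q′) (λ _ → refl) minpoly
          (möbius-step ω ((ω +ℝ fromℤ P) /ℝ Q) γ γ⁻¹ A (ι p) (ι p′) (ι q) (ι q′)
            γγ⁻¹≈1 ω≈A+γ⁻¹
            (subst (λ M → Möbiusℤ M γ ((ω +ℝ fromℤ P) /ℝ Q)) a≡ (cf⇒möbius a γ-cf))))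
  in ι≡0⇒≡0 _ (trans (ι-ω-coefficient A P Q t p p′ q) u≡0) ,
     ι≡0⇒≡0 _ (trans (ι-constant-term A P Q n p p′ q q′) (ℚ.neg-injective -v≡0))

-- Determinant and sign

-- Each factor (a 1; 1 0) has determinant -1, and determinants multiply.
det-cfMatrix : ∀ {h} (a : Vec ℤ h) p p′ q q′ → cfMatrix a ≡ mat p p′ q q′ →
  -1ℤ ^ h ≡ p * q′ - p′ * q
det-cfMatrix [] p p′ q q′ refl = refl
det-cfMatrix (a ∷ as) p p′ q q′ a≡ with cfMatrix as | det-cfMatrix as _ _ _ _ refl
det-cfMatrix (a ∷ as) p p′ q q′ refl | mat r r′ s s′ | det =
  trans (cong (-1ℤ *_) det) (expand a r r′ s s′)
  where
  expand : ∀ a r r′ s s′ → -1ℤ * (r * s′ - r′ * s) ≡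
    (a * r + 1ℤ * s) * (1ℤ * r′ + 0ℤ * s′) - (a * r′ + 1ℤ * s′) * (1ℤ * r + 0ℤ * s)
  expand = solve-∀

sign²≡1 : ∀ h → -1ℤ ^ h * -1ℤ ^ h ≡ 1ℤ
sign²≡1 ℕ.zero = refl
sign²≡1 (suc h) = trans (square (-1ℤ ^ h)) (sign²≡1 h)
  where
  square : ∀ s → -1ℤ * s * (-1ℤ * s) ≡ s * s
  square = solve-∀

-- The integer identities

module Identities (t n A P Q p p′ q q′ s : ℤ) where

  -- Every conclusion is an identity modulo the four vanishing quantities below,
  -- in which s stands for (-1)ʰ; the first arguments of vanish are the cofactors.
  vanish :
    let k = A - t - P
        N = A * A - t * A + n
        E₀ = s - (p * q′ - p′ * q)
        E₁ = q + k * p - p′ * Q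
        E₂ = p * N + q * (A + P) + q′ * Q
        E₃ = s * s - 1ℤ
    in E₀ ≡ 0ℤ → E₁ ≡ 0ℤ → E₂ ≡ 0ℤ → E₃ ≡ 0ℤ →
    ∀ {x y} c₀ c₁ c₂ c₃ → x ≡ y + (c₀ * E₀ + c₁ * E₁ + c₂ * E₂ + c₃ * E₃) → x ≡ y
  vanish e₀ e₁ e₂ e₃ {y = y} c₀ c₁ c₂ c₃ x≡ rewrite e₀ | e₁ | e₂ | e₃ =
    trans x≡ (zeros y c₀ c₁ c₂ c₃)
    where
    zeros : ∀ y c₀ c₁ c₂ c₃ →
      y + (c₀ * 0ℤ + c₁ * 0ℤ + c₂ * 0ℤ + c₃ * 0ℤ) ≡ y
    zeros = solve-∀

  -- The factor `-1ℤ * s` is what `-1ℤ ^ suc h` unfolds to when s = (-1)ʰ.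
  identities :
    let k = A - t - P
        T = t - + 2 * A
        N = A * A - t * A + n
        K₁ = q′ * T - p′ * N
        K₂ = K₁ + k * q′
        L = q′ * Q - k * q
    in
    s - (p * q′ - p′ * q) ≡ 0ℤ → q + k * p - p′ * Q ≡ 0ℤ →
    p * N + q * (A + P) + q′ * Q ≡ 0ℤ → s * s - 1ℤ ≡ 0ℤ →
    (P * P + t * P + n ≡ -1ℤ * s * (Q * (q′ * q′ - K₁ * p′)))
    × (- (A + P) ≡ -1ℤ * s * (q * q′ - K₁ * p))
    × (N ≡ -1ℤ * s * (q′ * q′ * Q - K₂ * q))
    × (- (A + P) ≡ -1ℤ * s * (p′ * q′ * Q - K₂ * p))
    × (K₂ - K₁ ≡ k * q′)
    × (-1ℤ * s * k ≡ q * q′ - L * p′)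
    × (-1ℤ * s * Q ≡ q * q - L * p)
    × (L ≡ q′ * Q - k * q)
    × (T ≡ s * (K₁ * p - L * p′))
    × (N ≡ s * (K₁ * q - L * q′))
    × (t * t - + 4 * n ≡ T * T - + 4 * N)
  identities e₀ e₁ e₂ e₃ =
    let k = A - t - P
        T = t - + 2 * A
        N = A * A - t * A + n
        K₁ = q′ * T - p′ * N
        vars : List ℤ
        vars = t ∷ n ∷ A ∷ P ∷ Q ∷ p ∷ p′ ∷ q ∷ q′ ∷ s ∷ []
    in
      -- The cofactors come from P² + tP + n = N - k(A + P).
      vanish e₀ e₁ e₂ e₃ (s * (N - k * (A + P))) (s * (K₁ + k * q′))
        (s * (q′ + k * p′)) (k * (A + P) - N) (solve vars)
    , vanish e₀ e₁ e₂ e₃ (- (s * (A + P))) (s * q′) (s * p′) (A + P) (solve vars)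
    -- K₂ q - q′² Q is K₁ q - L q′ rearranged, so these cofactors recur in the last formula for `N`.
    , vanish e₀ e₁ e₂ e₃ (s * N) 0ℤ (s * q′) (- N) (solve vars)
    , vanish e₀ e₁ e₂ e₃ (- (s * (A + P))) 0ℤ (s * p′) (A + P) (solve vars)
    , solve vars
    -- By E₁ = 0, q q′ - L p′ becomes -k(p q′ - p′ q); likewise q² - L p becomes -Q(p q′ - p′ q) in
    -- the next line.
    , vanish e₀ e₁ e₂ e₃ (- k) (- q′) 0ℤ 0ℤ (solve vars)
    , vanish e₀ e₁ e₂ e₃ (- Q) (- q) 0ℤ 0ℤ (solve vars)
    , refl
    -- With E₂ = 0 and A + P + k = -T, K₁ p - L p′ becomes (p q′ - p′ q) T = s T, and s² = 1.
    , vanish e₀ e₁ e₂ e₃ (s * T) 0ℤ (s * p′) (- T) (solve vars)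
    , vanish e₀ e₁ e₂ e₃ (s * N) 0ℤ (s * q′) (- N) (solve vars)
    , solve vars

-- The discriminant as a quadratic polynomial

-- The expansion of (p X - p′ Y)² - 4 s (q X - q′ Y); at X = K₁, Y = L it equals T² - 4N because s²
-- = 1.
discriminant : ℤ → (p p′ q q′ : ℤ) → Poly₂
discriminant s p p′ q q′ = record
  { cXX = p * p ; cXY = - (+ 2 * p * p′) ; cYY = p′ * p′
  ; cX = - (+ 4 * s * q) ; cY = + 4 * s * q′ ; c₁ = 0ℤ }

eval-discriminant : ∀ s p p′ q q′ K L {T N} → s * s ≡ 1ℤ →
  T ≡ s * (K * p - L * p′) → N ≡ s * (K * q - L * q′) →
  T * T - + 4 * N ≡ eval (discriminant s p p′ q q′) K L
eval-discriminant s p p′ q q′ K L {T} {N} s²≡1 refl refl = begin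
  T * T - + 4 * N
    ≡⟨ separate s p p′ q q′ K L ⟩
  s * s * ((K * p - L * p′) * (K * p - L * p′)) - + 4 * N
    ≡⟨ cong (λ r → r * ((K * p - L * p′) * (K * p - L * p′)) - + 4 * N) s²≡1 ⟩
  1ℤ * ((K * p - L * p′) * (K * p - L * p′)) - + 4 * N
    ≡⟨ expand s p p′ q q′ K L ⟩
  eval (discriminant s p p′ q q′) K L ∎
  where
  open ≡-Reasoning
  separate : ∀ s p p′ q q′ K L →
    s * (K * p - L * p′) * (s * (K * p - L * p′)) - + 4 * (s * (K * q - L * q′)) ≡
    s * s * ((K * p - L * p′) * (K * p - L * p′)) - + 4 * (s * (K * q - L * q′))
  separate = solve-∀
  expand : ∀ s p p′ q q′ K L →
    1ℤ * ((K * p - L * p′) * (K * p - L * p′)) - + 4 * (s * (K * q - L * q′)) ≡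
    p * p * K * K + - (+ 2 * p * p′) * K * L + p′ * p′ * L * L
      + - (+ 4 * s * q) * K + + 4 * s * q′ * L + 0ℤ
  expand = solve-∀

square≡0⇒≡0 : ∀ x → x * x ≡ 0ℤ → x ≡ 0ℤ
square≡0⇒≡0 x x²≡0 = [ id , id ]′ (ℤ.i*j≡0⇒i≡0∨j≡0 x x²≡0)

-- p and p′ cannot both vanish, since the determinant p q′ - p′ q is ±1.
discriminant-quadratic : ∀ {s} p p′ q q′ → s * s ≡ 1ℤ → s ≡ p * q′ - p′ * q →
  IsQuadratic (discriminant s p p′ q q′)
discriminant-quadratic {s} p p′ q q′ s²≡1 s≡ with p ℤ.≟ 0ℤ
... | no p≢0 = inj₁ (p≢0 ∘ square≡0⇒≡0 p)
... | yes refl = inj₂ (inj₂ (p′≢0 ∘ square≡0⇒≡0 p′))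
  where
  p′≢0 : p′ ≢ 0ℤ
  p′≢0 refl with trans (sym s²≡1) (cong (λ r → r * r) s≡)
  ... | ()

mainTheorem2 : ∀ (h : ℕ) → 1 ℕ.≤ h →
    ∀ (a : Vec ℤ h) → All (λ aᵢ → 0ℤ < aᵢ) a →
    -- F is chosen here so that its coefficients depend only on a₁,…,aₕ
    ∃ λ (F : Poly₂) → IsQuadratic F ×
    (∀ (t n : ℤ) (ω : ℝ) → Irrational ω →
     (ω *ℝ ω) -ℝ (fromℤ t *ℝ ω) +ℝ fromℤ n ≈ 0ℝ →
     ∀ (A P Q : ℤ) .{{_ : NonZero Q}} →
     ω commences[ A ∷ toList a ⨾ (ω +ℝ fromℤ P) /ℝ Q ] →
     ∀ (p p′ q q′ : ℤ) → cfMatrix a ≡ mat p p′ q q′ →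
     let k = A - t - P
         T = t - + 2 * A
         N = A * A - t * A + n
     in
     ∃ λ (K₁ : ℤ) → ∃ λ (K₂ : ℤ) → ∃ λ (L : ℤ) →
       (P * P + t * P + n ≡ -1ℤ ^ suc h * (Q * (q′ * q′ - K₁ * p′)))
       × (- (A + P) ≡ -1ℤ ^ suc h * (q * q′ - K₁ * p))
       × (A * A - t * A + n ≡ -1ℤ ^ suc h * (q′ * q′ * Q - K₂ * q))
       × (- (A + P) ≡ -1ℤ ^ suc h * (p′ * q′ * Q - K₂ * p))
       × (K₂ - K₁ ≡ k * q′)
       × (-1ℤ ^ suc h * k ≡ q * q′ - L * p′)
       × (-1ℤ ^ suc h * Q ≡ q * q - L * p)
       × (L ≡ q′ * Q - k * q)
       × (T ≡ -1ℤ ^ h * (K₁ * p - L * p′))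
       × (N ≡ -1ℤ ^ h * (K₁ * q - L * q′))
       × (t * t - + 4 * n ≡ T * T - + 4 * N)
       × (T * T - + 4 * N ≡ eval F K₁ L))
mainTheorem2 h _ a _ =
  -- The polynomial is chosen before p, p′, q, q′ are given, so it is built from the projections of
  -- `cfMatrix a`; the `refl` below identifies the two.
  discriminant (-1ℤ ^ h) e₁₁ e₁₂ e₂₁ e₂₂ ,
  discriminant-quadratic e₁₁ e₁₂ e₂₁ e₂₂ (sign²≡1 h)
    (det-cfMatrix a e₁₁ e₁₂ e₂₁ e₂₂ refl) ,
  λ { t n ω irr minpoly A P Q (cf , _) _ _ _ _ refl →
      let u≡0 , v≡0 = coefficients-vanish a t n ω irr minpoly A P Q cf
                        e₁₁ e₁₂ e₂₁ e₂₂ refl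
          k = A - t - P
          T = t - + 2 * A
          N = A * A - t * A + n
          K₁ = e₂₂ * T - e₁₂ * N
          i₁ , i₂ , i₃ , i₄ , i₅ , i₆ , i₇ , i₈ , T≡ , N≡ , disc =
            Identities.identities t n A P Q e₁₁ e₁₂ e₂₁ e₂₂ (-1ℤ ^ h)
              (ℤ.i≡j⇒i-j≡0 (det-cfMatrix a e₁₁ e₁₂ e₂₁ e₂₂ refl))
              -- With u and v the integers of `u≡0` and `v≡0`, E₁ is -u and E₂ is v - A u.
              (trans (E₁-from-u t A P Q e₁₁ e₁₂ e₂₁) (cong -_ u≡0))
              (trans (E₂-from-u-v t n A P Q e₁₁ e₁₂ e₂₁ e₂₂)
                     (trans (cong₂ (λ u v → v - A * u) u≡0 v≡0)
                            (cong (λ r → 0ℤ - r) (ℤ.*-zeroʳ A))))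
              (ℤ.i≡j⇒i-j≡0 (sign²≡1 h))
      in K₁ , K₁ + k * e₂₂ , e₂₂ * Q - k * e₂₁ ,
         i₁ , i₂ , i₃ , i₄ , i₅ , i₆ , i₇ , i₈ , T≡ , N≡ , disc ,
         eval-discriminant (-1ℤ ^ h) e₁₁ e₁₂ e₂₁ e₂₂ K₁ (e₂₂ * Q - k * e₂₁)
           (sign²≡1 h) T≡ N≡ }
  where
  open Matrix₂ (cfMatrix a)
  E₁-from-u : ∀ t A P Q p p′ q →
    q + (A - t - P) * p - p′ * Q ≡ - (p * (t + P - A) + p′ * Q - q)
  E₁-from-u = solve-∀
  E₂-from-u-v : ∀ t n A P Q p p′ q q′ →
    p * (A * A - t * A + n) + q * (A + P) + q′ * Q ≡
    (A * p + q) * P + (A * p′ + q′) * Q + p * n -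
    A * (p * (t + P - A) + p′ * Q - q)
  E₂-from-u-v = solve-∀
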